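{- Let $\mu$ be a refining Möbius map and $\alpha\in\mathbf{DIG}^{\omega}$. Then $P_h(\mu,\alpha)$ holds.
   Context: Möbius maps. $\mathbb{M}=\mathbb{Q}^4$ is the set of Möbius maps, i.e. rational $2\times 2$ matrices $\mu=\left[\begin{smallmatrix}a&b\\c&d\end{smallmatrix}\right]$ (no nonsingularity required), acting by $\mu(x)=\frac{ax+b}{cx+d}$. $\mu$ is bounded if $cx+d\neq 0$ for all $x\in[-1,1]$; $\mu$ is refining if it is bounded and $\mu([-1,1])\subseteq[-1,1]$. $\circ$ is the matrix product and $\phi^{ -1}$ the matrix inverse. Digits. $\mathbf{DIG}=\{\mathbf L,\mathbf R,\mathbf M\}$, interpreted as the matrices $\mathbf L=\left[\begin{smallmatrix}1/2&-1/2\\1/2&3/2\end{smallmatrix}\right]$, $\mathbf R=\left[\begin{smallmatrix}1/2&1/2\\-1/2&3/2\end{smallmatrix}\right]$, $\mathbf M=\left[\begin{smallmatrix}1&0\\0&3\end{smallmatrix}\right]$. $\mathbf{DIG}^{\omega}$ is the type of infinite streams over $\mathbf{DIG}$, with head $\mathsf{hd}$ and tail $\mathsf{tl}$. For $\mu\in\mathbb{M}$, $\phi\in\mathbf{DIG}$, the decidable emission condition $\mathbf{Incl}(\mu,\phi)$ means: $\mu$ is bounded and $\mu([-1,1])\subseteq\phi([-1,1])$. Productivity predicate. $E_h(\mu,\alpha)$ is the inductively defined (least) predicate with rules: if $\mathbf{Incl}(\mu,\phi)$ for some $\phi\in\mathbf{DIG}$ then $E_h(\mu,\alpha)$ (one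 rule for each of $\mathbf L,\mathbf R,\mathbf M$); if $E_h(\mu\circ\mathsf{hd}(\alpha),\mathsf{tl}(\alpha))$ then $E_h(\mu,\alpha)$. For a proof $t$ of $E_h(\mu,\alpha)$, the triple $\overline m_h(\mu,\alpha,t)\in\mathbf{DIG}\times\mathbb{M}\times\mathbf{DIG}^{\omega}$ is defined by structural recursion on $t$: it is $(\mathbf L,\mathbf L^{ -1}\circ\mu,\alpha)$ if $\mathbf{Incl}(\mu,\mathbf L)$; else $(\mathbf R,\mathbf R^{ -1}\circ\mu,\alpha)$ if $\mathbf{Incl}(\mu,\mathbf R)$; else $(\mathbf M,\mathbf M^{ -1}\circ\mu,\alpha)$ if $\mathbf{Incl}(\mu,\mathbf M)$; otherwise $\overline m_h(\mu\circ\mathsf{hd}(\alpha),\mathsf{tl}(\alpha),t')$, where $t'$ is the proof of $E_h(\mu\circ\mathsf{hd}(\alpha),\mathsf{tl}(\alpha))$ obtained from $t$ by inversion. $\pi_1,\pi_2,\pi_3$ are the projections of a triple. $\Psi_h(n,\mu,\alpha)$ ($n\in\mathbb{N}$) is the inductive predicate with rules: $E_h(\mu,\alpha)$ implies $\Psi_h(0,\mu,\alpha)$; for a proof $t$ of $E_h(\mu,\alpha)$, $\Psi_h(n,\pi_2(\overline m_h(\mu,\alpha,t)),\pi_3(\overline m_h(\mu,\alpha,t)))$ implies $\Psi_h(n+1,\mu,\alpha)$. Finally $P_h(\mu,\alpha):\Leftrightarrow\forall n\in\mathbb{N},\ \Psi_h(n+1,\mu,\alpha)$. -}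

module Defs where

open import Data.Integer.Base using (+_)
open import Data.Nat.Base using (ℕ; zero; suc)
open import Data.Product.Base using (_×_; _,_; proj₁; Σ; ∃)
open import Data.Rational.Base hiding (truncate)
open import Data.Rational.Properties
open import Data.Rational.Solver using (module +-*-Solver)
open import Data.Sum.Base using (_⊎_; inj₁; inj₂)
open import Level using (0ℓ)
open import Relation.Binary.Definitions using (tri<; tri≈; tri>)
open import Relation.Binary.PropositionalEquality
  using (_≡_; _≢_; refl; sym; trans; cong; subst; subst₂)
open import Relation.Nullary.Decidable using (Dec; yes; no; map′; _×-dec_; _⊎-dec_)
open import Relation.Nullary.Negation using (¬_; contradiction)
open import Relation.Unary using (Pred; _∈_; _⊆_)

record Möbius : Set where
  constructor mob
  field
    a b c d : ℚ

num : Möbius → ℚ → ℚ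
num (mob a b c d) x = a * x + b

den : Möbius → ℚ → ℚ
den (mob a b c d) x = c * x + d

apply : (μ : Möbius) (x : ℚ) → den μ x ≢ 0ℚ → ℚ
apply μ x nz = _÷_ (num μ x) (den μ x) {{≢-nonZero nz}}

infixr 9 _∘_

_∘_ : Möbius → Möbius → Möbius
mob a b c d ∘ mob a′ b′ c′ d′ =
  mob (a * a′ + b * c′) (a * b′ + b * d′)
      (c * a′ + d * c′) (c * b′ + d * d′)

det : Möbius → ℚ
det (mob a b c d) = a * d - b * c

inverse : (μ : Möbius) → .{{NonZero (det μ)}} → Möbius
inverse μ@(mob a b c d) = mob (d * k) (- b * k) (- c * k) (a * k)
  where k = 1/ det μ

-- The interval [-1,1] consists of rational points.  For maps with
-- rational coefficients this determines the same bounded maps and the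
-- same inclusions between images as the real interval: a pole -d/c is
-- itself rational, and a bounded map is continuous and monotone.
I : Pred ℚ 0ℓ
I x = - 1ℚ ≤ x × x ≤ 1ℚ

-- The points of P at which μ is undefined contribute nothing to μ [ P ].
_[_] : Möbius → Pred ℚ 0ℓ → Pred ℚ 0ℓ
(μ [ P ]) z = ∃ λ x → x ∈ P × Σ (den μ x ≢ 0ℚ) λ nz → apply μ x nz ≡ z

Bounded : Möbius → Set
Bounded μ = ∀ x → x ∈ I → den μ x ≢ 0ℚ

Refining : Möbius → Set
Refining μ = Bounded μ × μ [ I ] ⊆ I

data Digit : Set where
  L R M : Digit

⟦_⟧ : Digit → Möbius
⟦ L ⟧ = mob ½  -½  ½  (+ 3 / 2)
⟦ R ⟧ = mob ½  ½  -½  (+ 3 / 2)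
⟦ M ⟧ = mob 1ℚ 0ℚ 0ℚ (+ 3 / 1)

digit-nonsingular : ∀ φ → NonZero (det ⟦ φ ⟧)
digit-nonsingular L = _
digit-nonsingular R = _
digit-nonsingular M = _

⟦_⟧⁻¹ : Digit → Möbius
⟦ φ ⟧⁻¹ = inverse ⟦ φ ⟧ {{digit-nonsingular φ}}

-- The type Codata.Guarded.Stream, restated so that importing modules do
-- not need the guardedness flag.
record Stream (A : Set) : Set where
  coinductive
  field
    hd : A
    tl : Stream A

open Stream public

Incl : Möbius → Digit → Set
Incl μ φ = Bounded μ × μ [ I ] ⊆ ⟦ φ ⟧ [ I ]

-- The lemmas from here to Incl? establish decidability of Incl, on which
-- m̄ₕ branches: the sign of den μ and membership of the image in the
-- interval of a digit are both settled at the endpoints -1 and 1.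

open +-*-Solver using (solve; _:=_; _:+_; _:*_; _:-_; :-_; con)

-1∈I : - 1ℚ ∈ I
-1∈I = ≤-refl , ≤ᵇ⇒≤ _

1∈I : 1ℚ ∈ I
1∈I = ≤ᵇ⇒≤ _ , ≤-refl

0≤q-p : ∀ {p q} → p ≤ q → 0ℚ ≤ q - p
0≤q-p {p} {q} p≤q = subst (_≤ q - p) (+-inverseʳ p) (+-monoˡ-≤ (- p) p≤q)

0≤q-p⁻¹ : ∀ {p q} → 0ℚ ≤ q - p → p ≤ q
0≤q-p⁻¹ {p} {q} h = subst₂ _≤_ (+-identityˡ p)
  (solve 2 (λ p q → (q :- p) :+ p := q) refl p q) (+-monoˡ-≤ p h)

*-nonNeg : ∀ {p q} → 0ℚ ≤ p → 0ℚ ≤ q → 0ℚ ≤ p * q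
*-nonNeg {p} {q} 0≤p 0≤q =
  subst (_≤ p * q) (*-zeroʳ p) (*-monoˡ-≤-nonNeg p {{nonNegative 0≤p}} 0≤q)

+-nonNeg : ∀ {p q} → 0ℚ ≤ p → 0ℚ ≤ q → 0ℚ ≤ p + q
+-nonNeg = +-mono-≤

affine-≤ : ∀ u v u′ v′ →
  u * (- 1ℚ) + v ≤ u′ * (- 1ℚ) + v′ → u * 1ℚ + v ≤ u′ * 1ℚ + v′ →
  ∀ x → x ∈ I → u * x + v ≤ u′ * x + v′
affine-≤ u v u′ v′ h₋ h₊ x (-1≤x , x≤1) =
  0≤q-p⁻¹ (subst (0ℚ ≤_) (convex u v u′ v′ x) (+-nonNeg left right))
  where
  left : 0ℚ ≤ (½ * (1ℚ - x)) * ((u′ * (- 1ℚ) + v′) - (u * (- 1ℚ) + v))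
  left = *-nonNeg (*-nonNeg {½} (≤ᵇ⇒≤ _) (0≤q-p x≤1)) (0≤q-p h₋)
  right : 0ℚ ≤ (½ * (x - (- 1ℚ))) * ((u′ * 1ℚ + v′) - (u * 1ℚ + v))
  right = *-nonNeg (*-nonNeg {½} (≤ᵇ⇒≤ _) (0≤q-p -1≤x)) (0≤q-p h₊)
  convex : ∀ u v u′ v′ x →
    (½ * (1ℚ - x)) * ((u′ * (- 1ℚ) + v′) - (u * (- 1ℚ) + v))
    + (½ * (x - (- 1ℚ))) * ((u′ * 1ℚ + v′) - (u * 1ℚ + v))
    ≡ (u′ * x + v′) - (u * x + v)
  convex = solve 5 (λ u v u′ v′ x →
      (con ½ :* (con 1ℚ :- x)) :*
        ((u′ :* con (- 1ℚ) :+ v′) :- (u :* con (- 1ℚ) :+ v))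
      :+ (con ½ :* (x :- con (- 1ℚ))) :*
        ((u′ :* con 1ℚ :+ v′) :- (u :* con 1ℚ :+ v))
      := (u′ :* x :+ v′) :- (u :* x :+ v)) refl

÷-*-cancel : ∀ n d .{{_ : NonZero d}} → (n ÷ d) * d ≡ n
÷-*-cancel n d = trans (*-assoc n (1/ d) d)
  (trans (cong (n *_) (*-inverseˡ d)) (*-identityʳ n))

apply-*-den : ∀ μ x nz → apply μ x nz * den μ x ≡ num μ x
apply-*-den μ x nz = ÷-*-cancel (num μ x) (den μ x) {{≢-nonZero nz}}

*-cancelʳ-≡ : ∀ {p q} r → r ≢ 0ℚ → p * r ≡ q * r → p ≡ q
*-cancelʳ-≡ {p} {q} r r≢0 eq = trans (sym (lem p)) (trans (cong (_* s) eq) (lem q))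
  where
  s : ℚ
  s = (1/ r) {{≢-nonZero r≢0}}
  lem : ∀ t → (t * r) * s ≡ t
  lem t = trans (*-assoc t r s)
    (trans (cong (t *_) (*-inverseʳ r {{≢-nonZero r≢0}})) (*-identityʳ t))

apply-unique : ∀ μ x nz z → z * den μ x ≡ num μ x → apply μ x nz ≡ z
apply-unique μ x nz z eq =
  *-cancelʳ-≡ (den μ x) nz (trans (apply-*-den μ x nz) (sym eq))

EndpointSigns : Möbius → Set
EndpointSigns μ = (0ℚ < den μ (- 1ℚ) × 0ℚ < den μ 1ℚ)
                ⊎ (den μ (- 1ℚ) < 0ℚ × den μ 1ℚ < 0ℚ)

≤∧≢⇒< : ∀ {p q} → p ≤ q → p ≢ q → p < q
≤∧≢⇒< {p} {q} p≤q p≢q with <-cmp p q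
... | tri< p<q _ _ = p<q
... | tri≈ _ p≡q _ = contradiction p≡q p≢q
... | tri> _ _ q<p = contradiction (≤-antisym p≤q (<⇒≤ q<p)) p≢q

affine-lower : ∀ u v m → m ≤ u * (- 1ℚ) + v → m ≤ u * 1ℚ + v →
               ∀ x → x ∈ I → m ≤ u * x + v
affine-lower u v m h₋ h₊ x x∈I = subst (_≤ u * x + v) (const x)
  (affine-≤ 0ℚ m u v (subst (_≤ _) (sym (const (- 1ℚ))) h₋)
                     (subst (_≤ _) (sym (const 1ℚ)) h₊) x x∈I)
  where
  const : ∀ y → 0ℚ * y + m ≡ m
  const y = trans (cong (_+ m) (*-zeroˡ y)) (+-identityˡ m)

affine-pos : ∀ u v → 0ℚ < u * (- 1ℚ) + v → 0ℚ < u * 1ℚ + v →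
             ∀ x → x ∈ I → 0ℚ < u * x + v
affine-pos u v h₋ h₊ x x∈I with ≤-total (u * (- 1ℚ) + v) (u * 1ℚ + v)
... | inj₁ p≤q = <-≤-trans h₋ (affine-lower u v _ ≤-refl p≤q x x∈I)
... | inj₂ q≤p = <-≤-trans h₊ (affine-lower u v _ q≤p ≤-refl x x∈I)

neg-affine : ∀ u v x → - (u * x + v) ≡ - u * x + - v
neg-affine = solve 3 (λ u v x → :- (u :* x :+ v) := (:- u) :* x :+ (:- v)) refl

affine-neg : ∀ u v → u * (- 1ℚ) + v < 0ℚ → u * 1ℚ + v < 0ℚ →
             ∀ x → x ∈ I → u * x + v < 0ℚ
affine-neg u v h₋ h₊ x x∈I = subst (_< 0ℚ) (neg-involutive (u * x + v))
  (neg-antimono-< (subst (0ℚ <_) (sym (neg-affine u v x))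
    (affine-pos (- u) (- v) (flip (- 1ℚ) h₋) (flip 1ℚ h₊) x x∈I)))
  where
  neg-involutive : ∀ p → - (- p) ≡ p
  neg-involutive = solve 1 (λ p → :- (:- p) := p) refl
  flip : ∀ y → u * y + v < 0ℚ → 0ℚ < - u * y + - v
  flip y h = subst (0ℚ <_) (neg-affine u v y) (neg-antimono-< h)

SignConstant : Möbius → Set
SignConstant μ = (∀ x → x ∈ I → 0ℚ < den μ x) ⊎ (∀ x → x ∈ I → den μ x < 0ℚ)

endpoints⇒constant : ∀ μ → EndpointSigns μ → SignConstant μ
endpoints⇒constant (mob a b c d) (inj₁ (h₋ , h₊)) = inj₁ (affine-pos c d h₋ h₊)
endpoints⇒constant (mob a b c d) (inj₂ (h₋ , h₊)) = inj₂ (affine-neg c d h₋ h₊)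

constant⇒bounded : ∀ μ → SignConstant μ → Bounded μ
constant⇒bounded μ (inj₁ pos) x x∈I den≡0 = <⇒≢ (pos x x∈I) (sym den≡0)
constant⇒bounded μ (inj₂ neg) x x∈I den≡0 = <⇒≢ (neg x x∈I) den≡0

÷-lower : ∀ {k} n d .{{_ : NonZero d}} → 0ℚ < d → k * d ≤ n → k ≤ n ÷ d
÷-lower {k} n d 0<d h = *-cancelʳ-≤-pos d {{positive 0<d}}
  (subst (k * d ≤_) (sym (÷-*-cancel n d)) h)

÷-upper : ∀ {k} n d .{{_ : NonZero d}} → 0ℚ < d → n ≤ k * d → n ÷ d ≤ k
÷-upper {k} n d 0<d h = *-cancelʳ-≤-pos d {{positive 0<d}}
  (subst (_≤ k * d) (sym (÷-*-cancel n d)) h)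

-- An affine function of opposite signs at ±1 vanishes at
-- -(p + q) / (q - p), where p and q are its values at -1 and 1.
affine-root : ∀ u v →
  (u * (- 1ℚ) + v < 0ℚ × 0ℚ < u * 1ℚ + v) ⊎ (0ℚ < u * (- 1ℚ) + v × u * 1ℚ + v < 0ℚ) →
  ∃ λ x → x ∈ I × u * x + v ≡ 0ℚ
affine-root u v (inj₁ (p<0 , 0<q)) = r , (lo , hi) , vanishes
  where
  p q r : ℚ
  p = u * (- 1ℚ) + v
  q = u * 1ℚ + v
  0<q-p : 0ℚ < q - p
  0<q-p = +-mono-< 0<q (neg-antimono-< p<0)
  instance
    nz : NonZero (q - p)
    nz = >-nonZero 0<q-p
  r = (- (p + q)) ÷ (q - p)
  lo : - 1ℚ ≤ r
  lo = ÷-lower (- (p + q)) (q - p) 0<q-p (0≤q-p⁻¹ (subst (0ℚ ≤_) (eq p q)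
    (+-nonNeg (neg-antimono-≤ (<⇒≤ p<0)) (neg-antimono-≤ (<⇒≤ p<0)))))
    where
    eq : ∀ p q → - p + - p ≡ - (p + q) - - 1ℚ * (q - p)
    eq = solve 2 (λ p q →
      :- p :+ :- p := :- (p :+ q) :- con (- 1ℚ) :* (q :- p)) refl
  hi : r ≤ 1ℚ
  hi = ÷-upper (- (p + q)) (q - p) 0<q-p (0≤q-p⁻¹ (subst (0ℚ ≤_) (eq p q)
    (+-nonNeg (<⇒≤ 0<q) (<⇒≤ 0<q))))
    where
    eq : ∀ p q → q + q ≡ 1ℚ * (q - p) - - (p + q)
    eq = solve 2 (λ p q → q :+ q := con 1ℚ :* (q :- p) :- :- (p :+ q)) refl
  eq₁ : ∀ u v r → u * r + v ≡ ½ * (r * ((u * 1ℚ + v) - (u * (- 1ℚ) + v))) + v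
  eq₁ = solve 3 (λ u v r → u :* r :+ v
    := con ½ :* (r :* ((u :* con 1ℚ :+ v) :- (u :* con (- 1ℚ) :+ v))) :+ v) refl
  eq₂ : ∀ u v → ½ * (- ((u * (- 1ℚ) + v) + (u * 1ℚ + v))) + v ≡ 0ℚ
  eq₂ = solve 2 (λ u v →
    con ½ :* (:- ((u :* con (- 1ℚ) :+ v) :+ (u :* con 1ℚ :+ v))) :+ v := con 0ℚ) refl
  vanishes : u * r + v ≡ 0ℚ
  vanishes = trans (eq₁ u v r)
    (trans (cong (λ t → ½ * t + v) (÷-*-cancel (- (p + q)) (q - p))) (eq₂ u v))
affine-root u v (inj₂ (0<p , q<0)) =
  let x , x∈I , eq = affine-root (- u) (- v) (inj₁
        ( subst (_< 0ℚ) (neg-affine u v (- 1ℚ)) (neg-antimono-< 0<p)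
        , subst (0ℚ <_) (neg-affine u v 1ℚ) (neg-antimono-< q<0)))
  in x , x∈I , neg-injective (trans (neg-affine u v x) eq)

bounded⇒endpoints : ∀ μ → Bounded μ → EndpointSigns μ
bounded⇒endpoints μ@(mob a b c d) bd with <-cmp 0ℚ (den μ (- 1ℚ)) | <-cmp 0ℚ (den μ 1ℚ)
... | tri≈ _ e _ | _          = contradiction (sym e) (bd (- 1ℚ) -1∈I)
... | _          | tri≈ _ e _ = contradiction (sym e) (bd 1ℚ 1∈I)
... | tri< p _ _ | tri< q _ _ = inj₁ (p , q)
... | tri> _ _ p | tri> _ _ q = inj₂ (p , q)
... | tri< p _ _ | tri> _ _ q =
  let x , x∈I , eq = affine-root c d (inj₂ (p , q)) in contradiction eq (bd x x∈I)
... | tri> _ _ p | tri< q _ _ =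
  let x , x∈I , eq = affine-root c d (inj₁ (p , q)) in contradiction eq (bd x x∈I)

bounded? : ∀ μ → Dec (Bounded μ)
bounded? μ = map′
  (λ e → constant⇒bounded μ (endpoints⇒constant μ e)) (bounded⇒endpoints μ)
  (((0ℚ <? den μ (- 1ℚ)) ×-dec (0ℚ <? den μ 1ℚ))
    ⊎-dec ((den μ (- 1ℚ) <? 0ℚ) ×-dec (den μ 1ℚ <? 0ℚ)))

Between : ℚ → ℚ → Pred ℚ 0ℓ
Between l h z = l ≤ z × z ≤ h

÷-lower-neg : ∀ {k} n d .{{_ : NonZero d}} → d < 0ℚ → n ≤ k * d → k ≤ n ÷ d
÷-lower-neg {k} n d d<0 h = *-cancelʳ-≤-neg d {{negative d<0}}
  (subst (_≤ k * d) (sym (÷-*-cancel n d)) h)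

÷-upper-neg : ∀ {k} n d .{{_ : NonZero d}} → d < 0ℚ → k * d ≤ n → n ÷ d ≤ k
÷-upper-neg {k} n d d<0 h = *-cancelʳ-≤-neg d {{negative d<0}}
  (subst (k * d ≤_) (sym (÷-*-cancel n d)) h)

scale-affine : ∀ k u v x → k * (u * x + v) ≡ (k * u) * x + k * v
scale-affine = solve 4 (λ k u v x →
  k :* (u :* x :+ v) := (k :* u) :* x :+ k :* v) refl

scaled-≤ : ∀ k u v u′ v′ →
  k * (u * (- 1ℚ) + v) ≤ u′ * (- 1ℚ) + v′ → k * (u * 1ℚ + v) ≤ u′ * 1ℚ + v′ →
  ∀ x → x ∈ I → k * (u * x + v) ≤ u′ * x + v′
scaled-≤ k u v u′ v′ h₋ h₊ x x∈I = subst (_≤ _) (sym (scale-affine k u v x))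
  (affine-≤ (k * u) (k * v) u′ v′ (subst (_≤ _) (scale-affine k u v (- 1ℚ)) h₋)
    (subst (_≤ _) (scale-affine k u v 1ℚ) h₊) x x∈I)

scaled-≥ : ∀ k u v u′ v′ →
  u′ * (- 1ℚ) + v′ ≤ k * (u * (- 1ℚ) + v) → u′ * 1ℚ + v′ ≤ k * (u * 1ℚ + v) →
  ∀ x → x ∈ I → u′ * x + v′ ≤ k * (u * x + v)
scaled-≥ k u v u′ v′ h₋ h₊ x x∈I = subst (_ ≤_) (sym (scale-affine k u v x))
  (affine-≤ u′ v′ (k * u) (k * v) (subst (_ ≤_) (scale-affine k u v (- 1ℚ)) h₋)
    (subst (_ ≤_) (scale-affine k u v 1ℚ) h₊) x x∈I)

image-between : ∀ μ (bd : Bounded μ) l h →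
  apply μ (- 1ℚ) (bd (- 1ℚ) -1∈I) ∈ Between l h →
  apply μ 1ℚ (bd 1ℚ 1∈I) ∈ Between l h →
  μ [ I ] ⊆ Between l h
image-between μ@(mob a b c d) bd l h (l₋ , h₋) (l₊ , h₊) (x , x∈I , nz , refl)
  with endpoints⇒constant μ (bounded⇒endpoints μ bd)
... | inj₁ pos =
  ÷-lower (num μ x) (den μ x) {{≢-nonZero nz}} (pos x x∈I)
    (scaled-≤ l c d a b (clear -1∈I l₋) (clear 1∈I l₊) x x∈I) ,
  ÷-upper (num μ x) (den μ x) {{≢-nonZero nz}} (pos x x∈I)
    (scaled-≥ h c d a b (clear′ -1∈I h₋) (clear′ 1∈I h₊) x x∈I)
  where
  clear : ∀ {y k} (y∈I : y ∈ I) → k ≤ apply μ y (bd y y∈I) → k * den μ y ≤ num μ y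
  clear {y} {k} y∈I r = subst (k * den μ y ≤_) (apply-*-den μ y (bd y y∈I))
    (*-monoʳ-≤-nonNeg (den μ y) {{nonNegative (<⇒≤ (pos y y∈I))}} r)
  clear′ : ∀ {y k} (y∈I : y ∈ I) → apply μ y (bd y y∈I) ≤ k → num μ y ≤ k * den μ y
  clear′ {y} {k} y∈I r = subst (_≤ k * den μ y) (apply-*-den μ y (bd y y∈I))
    (*-monoʳ-≤-nonNeg (den μ y) {{nonNegative (<⇒≤ (pos y y∈I))}} r)
... | inj₂ neg =
  ÷-lower-neg (num μ x) (den μ x) {{≢-nonZero nz}} (neg x x∈I)
    (scaled-≥ l c d a b (clear -1∈I l₋) (clear 1∈I l₊) x x∈I) ,
  ÷-upper-neg (num μ x) (den μ x) {{≢-nonZero nz}} (neg x x∈I)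
    (scaled-≤ h c d a b (clear′ -1∈I h₋) (clear′ 1∈I h₊) x x∈I)
  where
  clear : ∀ {y k} (y∈I : y ∈ I) → k ≤ apply μ y (bd y y∈I) → num μ y ≤ k * den μ y
  clear {y} {k} y∈I r = subst (_≤ k * den μ y) (apply-*-den μ y (bd y y∈I))
    (*-monoʳ-≤-nonPos (den μ y) {{nonPositive (<⇒≤ (neg y y∈I))}} r)
  clear′ : ∀ {y k} (y∈I : y ∈ I) → apply μ y (bd y y∈I) ≤ k → k * den μ y ≤ num μ y
  clear′ {y} {k} y∈I r = subst (k * den μ y ≤_) (apply-*-den μ y (bd y y∈I))
    (*-monoʳ-≤-nonPos (den μ y) {{nonPositive (<⇒≤ (neg y y∈I))}} r)

lower upper : Digit → ℚ
lower L = - 1ℚ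
lower R = 0ℚ
lower M = - (+ 1 / 3)
upper L = 0ℚ
upper R = 1ℚ
upper M = + 1 / 3

digit-bounded : ∀ φ → Bounded ⟦ φ ⟧
digit-bounded φ = constant⇒bounded ⟦ φ ⟧ (endpoints⇒constant ⟦ φ ⟧ (inj₁ (signs φ)))
  where
  open import Data.Unit.Base using (tt)
  open import Relation.Nullary.Decidable using (toWitness)
  signs : ∀ φ → 0ℚ < den ⟦ φ ⟧ (- 1ℚ) × 0ℚ < den ⟦ φ ⟧ 1ℚ
  signs L = toWitness {a? = _ <? _} tt , toWitness {a? = _ <? _} tt
  signs R = toWitness {a? = _ <? _} tt , toWitness {a? = _ <? _} tt
  signs M = toWitness {a? = _ <? _} tt , toWitness {a? = _ <? _} tt

image⇒between : ∀ φ → ⟦ φ ⟧ [ I ] ⊆ Between (lower φ) (upper φ)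
image⇒between L = image-between ⟦ L ⟧ (digit-bounded L) _ _
  (≤ᵇ⇒≤ _ , ≤ᵇ⇒≤ _) (≤ᵇ⇒≤ _ , ≤ᵇ⇒≤ _)
image⇒between R = image-between ⟦ R ⟧ (digit-bounded R) _ _
  (≤ᵇ⇒≤ _ , ≤ᵇ⇒≤ _) (≤ᵇ⇒≤ _ , ≤ᵇ⇒≤ _)
image⇒between M = image-between ⟦ M ⟧ (digit-bounded M) _ _
  (≤ᵇ⇒≤ _ , ≤ᵇ⇒≤ _) (≤ᵇ⇒≤ _ , ≤ᵇ⇒≤ _)

preimage : ∀ φ y z → y ∈ I → z * den ⟦ φ ⟧ y ≡ num ⟦ φ ⟧ y → z ∈ ⟦ φ ⟧ [ I ]
preimage φ y z y∈I eq = y , y∈I , digit-bounded φ y y∈I ,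
  apply-unique ⟦ φ ⟧ y (digit-bounded φ y y∈I) z eq

between⇒image : ∀ φ → Between (lower φ) (upper φ) ⊆ ⟦ φ ⟧ [ I ]
between⇒image L {z} (-1≤z , z≤0) = preimage L y z (lo , hi)
  (trans (eq₁ y z) (trans (cong (λ t → ½ * y - ½ * t + + 3 / 2 * z)
    (÷-*-cancel n (1ℚ - z))) (eq₂ y z)))
  where
  n : ℚ
  n = + 3 / 1 * z + 1ℚ
  0<1-z : 0ℚ < 1ℚ - z
  0<1-z = +-mono-<-≤ {0ℚ} {1ℚ} {0ℚ} (positive⁻¹ 1ℚ) (neg-antimono-≤ z≤0)
  instance
    nz : NonZero (1ℚ - z)
    nz = >-nonZero 0<1-z
  y : ℚ
  y = n ÷ (1ℚ - z)
  lo : - 1ℚ ≤ y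
  lo = ÷-lower n (1ℚ - z) 0<1-z (0≤q-p⁻¹ (subst (0ℚ ≤_) (eq z)
    (+-nonNeg (0≤q-p -1≤z) (0≤q-p -1≤z))))
    where
    eq : ∀ z → (z - - 1ℚ) + (z - - 1ℚ) ≡ (+ 3 / 1 * z + 1ℚ) - - 1ℚ * (1ℚ - z)
    eq = solve 1 (λ z → (z :- con (- 1ℚ)) :+ (z :- con (- 1ℚ))
      := (con (+ 3 / 1) :* z :+ con 1ℚ) :- con (- 1ℚ) :* (con 1ℚ :- z)) refl
  hi : y ≤ 1ℚ
  hi = ÷-upper n (1ℚ - z) 0<1-z (0≤q-p⁻¹ (subst (0ℚ ≤_) (eq z)
    (*-nonNeg {+ 4 / 1} (≤ᵇ⇒≤ _) (neg-antimono-≤ z≤0))))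
    where
    eq : ∀ z → + 4 / 1 * - z ≡ 1ℚ * (1ℚ - z) - (+ 3 / 1 * z + 1ℚ)
    eq = solve 1 (λ z → con (+ 4 / 1) :* :- z
      := con 1ℚ :* (con 1ℚ :- z) :- (con (+ 3 / 1) :* z :+ con 1ℚ)) refl
  eq₁ : ∀ y z → z * (½ * y + + 3 / 2) ≡ ½ * y - ½ * (y * (1ℚ - z)) + + 3 / 2 * z
  eq₁ = solve 2 (λ y z → z :* (con ½ :* y :+ con (+ 3 / 2))
    := con ½ :* y :- con ½ :* (y :* (con 1ℚ :- z)) :+ con (+ 3 / 2) :* z) refl
  eq₂ : ∀ y z → ½ * y - ½ * (+ 3 / 1 * z + 1ℚ) + + 3 / 2 * z ≡ ½ * y + -½
  eq₂ = solve 2 (λ y z →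
    con ½ :* y :- con ½ :* (con (+ 3 / 1) :* z :+ con 1ℚ) :+ con (+ 3 / 2) :* z
    := con ½ :* y :+ con -½) refl
between⇒image R {z} (0≤z , z≤1) = preimage R y z (lo , hi)
  (trans (eq₁ y z) (trans (cong (λ t → ½ * y - ½ * t + + 3 / 2 * z)
    (÷-*-cancel n (1ℚ + z))) (eq₂ y z)))
  where
  n : ℚ
  n = + 3 / 1 * z - 1ℚ
  0<1+z : 0ℚ < 1ℚ + z
  0<1+z = +-mono-<-≤ {0ℚ} {1ℚ} {0ℚ} (positive⁻¹ 1ℚ) 0≤z
  instance
    nz : NonZero (1ℚ + z)
    nz = >-nonZero 0<1+z
  y : ℚ
  y = n ÷ (1ℚ + z)
  lo : - 1ℚ ≤ y
  lo = ÷-lower n (1ℚ + z) 0<1+z (0≤q-p⁻¹ (subst (0ℚ ≤_) (eq z)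
    (*-nonNeg {+ 4 / 1} (≤ᵇ⇒≤ _) 0≤z)))
    where
    eq : ∀ z → + 4 / 1 * z ≡ (+ 3 / 1 * z - 1ℚ) - - 1ℚ * (1ℚ + z)
    eq = solve 1 (λ z → con (+ 4 / 1) :* z
      := (con (+ 3 / 1) :* z :- con 1ℚ) :- con (- 1ℚ) :* (con 1ℚ :+ z)) refl
  hi : y ≤ 1ℚ
  hi = ÷-upper n (1ℚ + z) 0<1+z (0≤q-p⁻¹ (subst (0ℚ ≤_) (eq z)
    (+-nonNeg (0≤q-p z≤1) (0≤q-p z≤1))))
    where
    eq : ∀ z → (1ℚ - z) + (1ℚ - z) ≡ 1ℚ * (1ℚ + z) - (+ 3 / 1 * z - 1ℚ)
    eq = solve 1 (λ z → (con 1ℚ :- z) :+ (con 1ℚ :- z)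
      := con 1ℚ :* (con 1ℚ :+ z) :- (con (+ 3 / 1) :* z :- con 1ℚ)) refl
  eq₁ : ∀ y z → z * (-½ * y + + 3 / 2) ≡ ½ * y - ½ * (y * (1ℚ + z)) + + 3 / 2 * z
  eq₁ = solve 2 (λ y z → z :* (con -½ :* y :+ con (+ 3 / 2))
    := con ½ :* y :- con ½ :* (y :* (con 1ℚ :+ z)) :+ con (+ 3 / 2) :* z) refl
  eq₂ : ∀ y z → ½ * y - ½ * (+ 3 / 1 * z - 1ℚ) + + 3 / 2 * z ≡ ½ * y + ½
  eq₂ = solve 2 (λ y z →
    con ½ :* y :- con ½ :* (con (+ 3 / 1) :* z :- con 1ℚ) :+ con (+ 3 / 2) :* z
    := con ½ :* y :+ con ½) refl
between⇒image M {z} (l≤z , z≤u) = preimage M (+ 3 / 1 * z) z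
  (*-monoˡ-≤-nonNeg (+ 3 / 1) l≤z , *-monoˡ-≤-nonNeg (+ 3 / 1) z≤u) (eq z)
  where
  eq : ∀ z → z * (0ℚ * (+ 3 / 1 * z) + + 3 / 1) ≡ 1ℚ * (+ 3 / 1 * z) + 0ℚ
  eq = solve 1 (λ z →
    z :* (con 0ℚ :* (con (+ 3 / 1) :* z) :+ con (+ 3 / 1))
    := con 1ℚ :* (con (+ 3 / 1) :* z) :+ con 0ℚ) refl

Incl? : ∀ μ φ → Dec (Incl μ φ)
Incl? μ φ with bounded? μ
... | no ¬bd = no λ incl → ¬bd (proj₁ incl)
... | yes bd = map′
  (λ (e₋ , e₊) → bd , λ z∈ →
    between⇒image φ (image-between μ bd (lower φ) (upper φ) e₋ e₊ z∈))
  (λ (_ , sub) →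
    image⇒between φ (sub (- 1ℚ , -1∈I , bd (- 1ℚ) -1∈I , refl)) ,
    image⇒between φ (sub (1ℚ , 1∈I , bd 1ℚ 1∈I , refl)))
  (between? (apply μ (- 1ℚ) (bd (- 1ℚ) -1∈I)) ×-dec between? (apply μ 1ℚ (bd 1ℚ 1∈I)))
  where
  between? : ∀ z → Dec (Between (lower φ) (upper φ) z)
  between? z = (lower φ ≤? z) ×-dec (z ≤? upper φ)

data Eₕ (μ : Möbius) (α : Stream Digit) : Set where
  emit-L : Incl μ L → Eₕ μ α
  emit-R : Incl μ R → Eₕ μ α
  emit-M : Incl μ M → Eₕ μ α
  absorb : Eₕ (μ ∘ ⟦ hd α ⟧) (tl α) → Eₕ μ α

-- The proof of Eₕ is inspected only once all three inclusions have failed,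
-- so the emitted digit follows the priority L, R, M and not the rule used in t.
m̄ₕ : ∀ μ α → Eₕ μ α → Digit × Möbius × Stream Digit
m̄ₕ μ α t with Incl? μ L
... | yes _ = L , ⟦ L ⟧⁻¹ ∘ μ , α
... | no ¬L with Incl? μ R
... | yes _ = R , ⟦ R ⟧⁻¹ ∘ μ , α
... | no ¬R with Incl? μ M
... | yes _ = M , ⟦ M ⟧⁻¹ ∘ μ , α
... | no ¬M with t
... | emit-L incl = contradiction incl ¬L
... | emit-R incl = contradiction incl ¬R
... | emit-M incl = contradiction incl ¬M
... | absorb t′ = m̄ₕ (μ ∘ ⟦ hd α ⟧) (tl α) t′

π₁ : Digit × Möbius × Stream Digit → Digit
π₁ (φ , _ , _) = φ

π₂ : Digit × Möbius × Stream Digit → Möbius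
π₂ (_ , μ , _) = μ

π₃ : Digit × Möbius × Stream Digit → Stream Digit
π₃ (_ , _ , α) = α

data Ψₕ : ℕ → Möbius → Stream Digit → Set where
  Ψ-zero : ∀ {μ α} → Eₕ μ α → Ψₕ zero μ α
  Ψ-suc  : ∀ {n μ α} (t : Eₕ μ α) →
           Ψₕ n (π₂ (m̄ₕ μ α t)) (π₃ (m̄ₕ μ α t)) → Ψₕ (suc n) μ α

Pₕ : Möbius → Stream Digit → Set
Pₕ μ α = ∀ n → Ψₕ (suc n) μ α

{-# OPTIONS --safe #-}

-- Let q₋, q₊ be the values of den μ at ±1, and let the cross of μ be the
-- difference of the endpoint images times q₋ q₊.  Composing μ with a digit φ
-- multiplies the cross by k = det φ, and it maps (q₋, q₊) by a nonnegative
-- matrix.  If ε ≤ q₋², q₊², then the product q₋ q₊ becomes at least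
-- k (q₋ q₊ + ε), and kε is again a lower bound for the squares.  Hence after
-- finitely many absorptions the image of [-1,1] has width at most 1/3.  Such a
-- subinterval of [-1,1] lies in the image of L or of R if 0 is not in its
-- interior, and in [-1/3,1/3] otherwise.
module Submission where

open import Defs

open import Algebra.Bundles using (Ring)
import Algebra.Properties.Semiring.Mult as Mult
open import Data.Integer.Base as ℤ using (+_; -[1+_])
import Data.Integer.Properties as ℤ
open import Data.Nat.Base using (ℕ; zero; suc; z≤n; s≤s)
import Data.Nat.Properties as ℕ
open import Data.Product.Base using (_×_; _,_; proj₁; proj₂; ∃)
open import Data.Rational.Base hiding (truncate)
open import Data.Rational.Properties
open import Data.Rational.Solver using (module +-*-Solver)
open import Data.Rational.Unnormalised.Base as ℚᵘ using (mkℚᵘ)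
import Data.Rational.Unnormalised.Properties as ℚᵘ
open import Data.Sum.Base using (inj₁; inj₂)
open import Relation.Binary.PropositionalEquality
  using (_≡_; _≢_; refl; sym; trans; cong; cong₂; subst; subst₂)
open import Relation.Nullary.Decidable using (yes; no)
open import Relation.Nullary.Negation using (contradiction)
open import Relation.Unary using (_∈_; _⊆_)

open Mult (Ring.semiring +-*-ring) using (×-comm-*; ×-assoc-*) renaming (_×_ to _·_)
open +-*-Solver using (solve; _:=_; _:+_; _:*_; _:-_; :-_; con)

-- The Archimedean property of the rationals.

toℚᵘ-homo-·1 : ∀ n → toℚᵘ (n · 1ℚ) ℚᵘ.≃ mkℚᵘ (+ n) 0
toℚᵘ-homo-·1 zero    = ℚᵘ.≃-refl
toℚᵘ-homo-·1 (suc n) = ℚᵘ.≃-trans (toℚᵘ-homo-+ 1ℚ (n · 1ℚ))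
  (ℚᵘ.≃-trans (ℚᵘ.+-congʳ (toℚᵘ 1ℚ) (toℚᵘ-homo-·1 n))
    (ℚᵘ.*≡* (cong (λ i → (+ 1 ℤ.+ i) ℤ.* + 1) (ℤ.*-identityʳ (+ n)))))

-- The denominator of `p` is at least 1. Cross-multiplication in the unnormalised rationals, where
-- `n · 1ℚ` is n/1, reduces the claim to integers.
p≤∣↥p∣·1 : ∀ p → p ≤ ℤ.∣ ↥ p ∣ · 1ℚ
p≤∣↥p∣·1 p@record{} = toℚᵘ-cancel-≤
  (ℚᵘ.≤-respʳ-≃ (ℚᵘ.≃-sym (toℚᵘ-homo-·1 ℤ.∣ ↥ p ∣)) (ℚᵘ.*≤* (bound p)))
  where
  bound : ∀ p → ↥ p ℤ.* + 1 ℤ.≤ + ℤ.∣ ↥ p ∣ ℤ.* ↧ p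
  bound (mkℚ (+ n) d _) = subst₂ ℤ._≤_ (ℤ.pos-* n 1) (ℤ.pos-* n (suc d))
    (ℤ.+≤+ (ℕ.*-monoʳ-≤ n (s≤s z≤n)))
  bound (mkℚ -[1+ n ] d _) = ℤ.-≤+

archimedean : ∀ p {ε} → 0ℚ < ε → ∃ λ n → p ≤ n · ε
archimedean p {ε} 0<ε = n , subst₂ _≤_ (÷-*-cancel p ε)
    (trans (×-assoc-* n 1ℚ ε) (cong (n ·_) (*-identityˡ ε)))
    (*-monoʳ-≤-nonNeg ε {{nonNegative (<⇒≤ 0<ε)}} (p≤∣↥p∣·1 (p ÷ ε)))
  where
  instance
    nz : NonZero ε
    nz = >-nonZero 0<ε
  n : ℕ
  n = ℤ.∣ ↥ (p ÷ ε) ∣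

-- Composition with a digit and emission of a digit preserve refining maps.

num-∘ : ∀ μ ν x → num (μ ∘ ν) x ≡ Möbius.a μ * num ν x + Möbius.b μ * den ν x
num-∘ (mob a b c d) (mob a′ b′ c′ d′) = expand a b a′ b′ c′ d′
  where
  expand : ∀ a b a′ b′ c′ d′ x →
    (a * a′ + b * c′) * x + (a * b′ + b * d′) ≡ a * (a′ * x + b′) + b * (c′ * x + d′)
  expand = solve 7 (λ a b a′ b′ c′ d′ x →
    (a :* a′ :+ b :* c′) :* x :+ (a :* b′ :+ b :* d′)
    := a :* (a′ :* x :+ b′) :+ b :* (c′ :* x :+ d′)) refl

den-∘ : ∀ μ ν x → den (μ ∘ ν) x ≡ Möbius.c μ * num ν x + Möbius.d μ * den ν x
-- A denominator is the numerator of the map with its rows exchanged, and exchanging rows commutes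
-- with composition on the right.
den-∘ (mob a b c d) ν = num-∘ (mob c d a b) ν

-- Passage from homogeneous coordinates (f : e) to the affine coordinate y = f/e.
homogeneous : ∀ u v {f e y} → y * e ≡ f → u * f + v * e ≡ (u * y + v) * e
homogeneous u v {e = e} {y} refl = expand u v y e
  where
  expand : ∀ u v y e → u * (y * e) + v * e ≡ (u * y + v) * e
  expand = solve 4 (λ u v y e → u :* (y :* e) :+ v :* e := (u :* y :+ v) :* e) refl

*-nonZero : ∀ {p q} → p ≢ 0ℚ → q ≢ 0ℚ → p * q ≢ 0ℚ
*-nonZero {p} {q} p≢0 q≢0 pq≡0 =
  p≢0 (*-cancelʳ-≡ q q≢0 (trans pq≡0 (sym (*-zeroˡ q))))

-- The denominator of the composite at x is the product of `den μ` at ν(x) and `den ν` at x. Since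
-- ν(x) stays in `I`, neither factor vanishes.
refining-∘ : ∀ μ ν → Refining μ → Refining ν → Refining (μ ∘ ν)
refining-∘ μ@(mob a b c d) ν (bd-μ , sub-μ) (bd-ν , sub-ν) = bd , sub
  where
  module _ x (x∈I : x ∈ I) where
    y : ℚ
    y = apply ν x (bd-ν x x∈I)
    y∈I : y ∈ I
    y∈I = sub-ν (x , x∈I , bd-ν x x∈I , refl)
    y-eq : y * den ν x ≡ num ν x
    y-eq = apply-*-den ν x (bd-ν x x∈I)
    den-eq : den (μ ∘ ν) x ≡ den μ y * den ν x
    den-eq = trans (den-∘ μ ν x) (homogeneous c d y-eq)
    num-eq : num (μ ∘ ν) x ≡ num μ y * den ν x
    num-eq = trans (num-∘ μ ν x) (homogeneous a b y-eq)
  bd : Bounded (μ ∘ ν)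
  bd x x∈I = subst (_≢ 0ℚ) (sym (den-eq x x∈I))
    (*-nonZero (bd-μ (y x x∈I) (y∈I x x∈I)) (bd-ν x x∈I))
  sub : (μ ∘ ν) [ I ] ⊆ I
  sub (x , x∈I , nz , refl) = subst I (sym (apply-unique (μ ∘ ν) x nz z eq))
    (sub-μ (y x x∈I , y∈I x x∈I , nz-μ , refl))
    where
    nz-μ : den μ (y x x∈I) ≢ 0ℚ
    nz-μ = bd-μ (y x x∈I) (y∈I x x∈I)
    z : ℚ
    z = apply μ (y x x∈I) nz-μ
    eq : z * den (μ ∘ ν) x ≡ num (μ ∘ ν) x
    eq = trans (cong (z *_) (den-eq x x∈I)) (trans
      (sym (*-assoc z (den μ (y x x∈I)) (den ν x)))
      (trans (cong (_* den ν x) (apply-*-den μ (y x x∈I) nz-μ)) (sym (num-eq x x∈I))))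

between⊆I : ∀ φ → Between (lower φ) (upper φ) ⊆ I
between⊆I L (l , h) = l , ≤-trans h (≤ᵇ⇒≤ _)
between⊆I R (l , h) = ≤-trans (≤ᵇ⇒≤ _) l , h
between⊆I M (l , h) = ≤-trans (≤ᵇ⇒≤ _) l , ≤-trans h (≤ᵇ⇒≤ _)

digit-refining : ∀ φ → Refining ⟦ φ ⟧
digit-refining φ = digit-bounded φ , λ z∈ → between⊆I φ (image⇒between φ z∈)

-- With μ x = φ y, the matrix φ⁻¹ ∘ μ sends x to y with denominator
-- den μ x / den φ y.
inverse-cancel : ∀ μ φ x y z → z * den μ x ≡ num μ x → z * den ⟦ φ ⟧ y ≡ num ⟦ φ ⟧ y →
  den (⟦ φ ⟧⁻¹ ∘ μ) x * den ⟦ φ ⟧ y ≡ den μ x ×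
  num (⟦ φ ⟧⁻¹ ∘ μ) x * den ⟦ φ ⟧ y ≡ y * den μ x
inverse-cancel μ φ x y z eq-μ eq-φ =
  trans (cong (_* e) (den-∘ ⟦ φ ⟧⁻¹ μ x))
    (trans (reduce c d) (trans (cong (_* δ) (den-eq φ y)) (*-identityˡ δ))) ,
  trans (cong (_* e) (num-∘ ⟦ φ ⟧⁻¹ μ x)) (trans (reduce a b) (cong (_* δ) (num-eq φ y)))
  where
  open Möbius ⟦ φ ⟧⁻¹
  e δ : ℚ
  e = den ⟦ φ ⟧ y
  δ = den μ x
  swap : ∀ u v z δ e → ((u * z + v) * δ) * e ≡ (u * (z * e) + v * e) * δ
  swap = solve 5 (λ u v z δ e →
    ((u :* z :+ v) :* δ) :* e := (u :* (z :* e) :+ v :* e) :* δ) refl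
  reduce : ∀ u v → (u * num μ x + v * δ) * e ≡ (u * num ⟦ φ ⟧ y + v * e) * δ
  reduce u v = trans (cong (_* e) (homogeneous u v eq-μ))
    (trans (swap u v z δ e) (cong (λ f → (u * f + v * e) * δ) eq-φ))
  -- `den-eq` and `num-eq` are the two rows of φ⁻¹φ = 1 applied to (y, 1), with the entries of the
  -- inverses written out.
  den-eq : ∀ φ y → Möbius.c ⟦ φ ⟧⁻¹ * num ⟦ φ ⟧ y + Möbius.d ⟦ φ ⟧⁻¹ * den ⟦ φ ⟧ y ≡ 1ℚ
  den-eq L = solve 1 (λ y → con -½ :* (con ½ :* y :+ con -½)
    :+ con ½ :* (con ½ :* y :+ con (+ 3 / 2)) := con 1ℚ) refl
  den-eq R = solve 1 (λ y → con ½ :* (con ½ :* y :+ con ½)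
    :+ con ½ :* (con -½ :* y :+ con (+ 3 / 2)) := con 1ℚ) refl
  den-eq M = solve 1 (λ y → con 0ℚ :* (con 1ℚ :* y :+ con 0ℚ)
    :+ con (+ 1 / 3) :* (con 0ℚ :* y :+ con (+ 3 / 1)) := con 1ℚ) refl
  num-eq : ∀ φ y → Möbius.a ⟦ φ ⟧⁻¹ * num ⟦ φ ⟧ y + Möbius.b ⟦ φ ⟧⁻¹ * den ⟦ φ ⟧ y ≡ y
  num-eq L = solve 1 (λ y → con (+ 3 / 2) :* (con ½ :* y :+ con -½)
    :+ con ½ :* (con ½ :* y :+ con (+ 3 / 2)) := y) refl
  num-eq R = solve 1 (λ y → con (+ 3 / 2) :* (con ½ :* y :+ con ½)
    :+ con -½ :* (con -½ :* y :+ con (+ 3 / 2)) := y) refl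
  num-eq M = solve 1 (λ y → con 1ℚ :* (con 1ℚ :* y :+ con 0ℚ)
    :+ con 0ℚ :* (con 0ℚ :* y :+ con (+ 3 / 1)) := y) refl

-- The inclusion supplies y in `I` with φ(y) = μ(x), and this y is the value of φ⁻¹ ∘ μ at x. Its
-- denominator there is nonzero because multiplying it by `den ⟦ φ ⟧ y` gives `den μ x`.
emit-refining : ∀ μ φ → Incl μ φ → Refining (⟦ φ ⟧⁻¹ ∘ μ)
emit-refining μ φ (bd-μ , sub-μ) = bd , sub
  where
  module _ x (x∈I : x ∈ I) where
    preimg : apply μ x (bd-μ x x∈I) ∈ ⟦ φ ⟧ [ I ]
    preimg = sub-μ (x , x∈I , bd-μ x x∈I , refl)
    y : ℚ
    y = proj₁ preimg
    y∈I : y ∈ I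
    y∈I = proj₁ (proj₂ preimg)
    cancel : den (⟦ φ ⟧⁻¹ ∘ μ) x * den ⟦ φ ⟧ y ≡ den μ x ×
             num (⟦ φ ⟧⁻¹ ∘ μ) x * den ⟦ φ ⟧ y ≡ y * den μ x
    cancel = inverse-cancel μ φ x y (apply μ x (bd-μ x x∈I)) (apply-*-den μ x (bd-μ x x∈I))
      (trans (cong (_* den ⟦ φ ⟧ y) (sym (proj₂ (proj₂ (proj₂ preimg)))))
        (apply-*-den ⟦ φ ⟧ y (proj₁ (proj₂ (proj₂ preimg)))))
  bd : Bounded (⟦ φ ⟧⁻¹ ∘ μ)
  bd x x∈I den≡0 = bd-μ x x∈I (trans (sym (proj₁ (cancel x x∈I)))
    (trans (cong (_* den ⟦ φ ⟧ (y x x∈I)) den≡0) (*-zeroˡ (den ⟦ φ ⟧ (y x x∈I)))))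
  sub : (⟦ φ ⟧⁻¹ ∘ μ) [ I ] ⊆ I
  sub (x , x∈I , nz , refl) = subst I
    (sym (apply-unique (⟦ φ ⟧⁻¹ ∘ μ) x nz (y x x∈I)
      (*-cancelʳ-≡ e (digit-bounded φ _ (y∈I x x∈I))
        (trans (*-assoc (y x x∈I) _ e)
          (trans (cong (y x x∈I *_) (proj₁ (cancel x x∈I))) (sym (proj₂ (cancel x x∈I))))))))
    (y∈I x x∈I)
    where
    e : ℚ
    e = den ⟦ φ ⟧ (y x x∈I)

-- The case distinction follows that of `m̄ₕ`: an emission is covered by `emit-refining`, an
-- absorption by `refining-∘`.
m̄ₕ-refining : ∀ μ α (t : Eₕ μ α) → Refining μ → Refining (π₂ (m̄ₕ μ α t))
m̄ₕ-refining μ α t ref with Incl? μ L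
... | yes incl = emit-refining μ L incl
... | no ¬L with Incl? μ R
... | yes incl = emit-refining μ R incl
... | no ¬R with Incl? μ M
... | yes incl = emit-refining μ M incl
... | no ¬M with t
... | emit-L incl = contradiction incl ¬L
... | emit-R incl = contradiction incl ¬R
... | emit-M incl = contradiction incl ¬M
... | absorb t′ = m̄ₕ-refining (μ ∘ ⟦ hd α ⟧) (tl α) t′
  (refining-∘ μ ⟦ hd α ⟧ ref (digit-refining (hd α)))

-- Endpoint denominators, cross and narrowing of the image under absorption.

q₋ q₊ cross : Möbius → ℚ
q₋ μ = den μ (- 1ℚ)
q₊ μ = den μ 1ℚ
cross μ = num μ 1ℚ * q₋ μ - num μ (- 1ℚ) * q₊ μ

-- Expanded, `cross μ` is 2 det μ, so this is multiplicativity of the determinant. The leading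
-- constants 1, 1 and 3 on the right are the determinants of `L`, `R` and `M`.
cross-∘ : ∀ μ φ → cross (μ ∘ ⟦ φ ⟧) ≡ det ⟦ φ ⟧ * cross μ
cross-∘ (mob a b c d) L = solve 4 (λ a b c d →
  ((a :* con ½ :+ b :* con ½) :* con 1ℚ :+ (a :* con -½ :+ b :* con (+ 3 / 2)))
    :* ((c :* con ½ :+ d :* con ½) :* con (- 1ℚ) :+ (c :* con -½ :+ d :* con (+ 3 / 2)))
  :- ((a :* con ½ :+ b :* con ½) :* con (- 1ℚ) :+ (a :* con -½ :+ b :* con (+ 3 / 2)))
    :* ((c :* con ½ :+ d :* con ½) :* con 1ℚ :+ (c :* con -½ :+ d :* con (+ 3 / 2)))
  := con 1ℚ :* ((a :* con 1ℚ :+ b) :* (c :* con (- 1ℚ) :+ d)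
              :- (a :* con (- 1ℚ) :+ b) :* (c :* con 1ℚ :+ d))) refl a b c d
cross-∘ (mob a b c d) R = solve 4 (λ a b c d →
  ((a :* con ½ :+ b :* con -½) :* con 1ℚ :+ (a :* con ½ :+ b :* con (+ 3 / 2)))
    :* ((c :* con ½ :+ d :* con -½) :* con (- 1ℚ) :+ (c :* con ½ :+ d :* con (+ 3 / 2)))
  :- ((a :* con ½ :+ b :* con -½) :* con (- 1ℚ) :+ (a :* con ½ :+ b :* con (+ 3 / 2)))
    :* ((c :* con ½ :+ d :* con -½) :* con 1ℚ :+ (c :* con ½ :+ d :* con (+ 3 / 2)))
  := con 1ℚ :* ((a :* con 1ℚ :+ b) :* (c :* con (- 1ℚ) :+ d)
              :- (a :* con (- 1ℚ) :+ b) :* (c :* con 1ℚ :+ d))) refl a b c d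
cross-∘ (mob a b c d) M = solve 4 (λ a b c d →
  ((a :* con 1ℚ :+ b :* con 0ℚ) :* con 1ℚ :+ (a :* con 0ℚ :+ b :* con (+ 3 / 1)))
    :* ((c :* con 1ℚ :+ d :* con 0ℚ) :* con (- 1ℚ) :+ (c :* con 0ℚ :+ d :* con (+ 3 / 1)))
  :- ((a :* con 1ℚ :+ b :* con 0ℚ) :* con (- 1ℚ) :+ (a :* con 0ℚ :+ b :* con (+ 3 / 1)))
    :* ((c :* con 1ℚ :+ d :* con 0ℚ) :* con 1ℚ :+ (c :* con 0ℚ :+ d :* con (+ 3 / 1)))
  := con (+ 3 / 1) :* ((a :* con 1ℚ :+ b) :* (c :* con (- 1ℚ) :+ d)
              :- (a :* con (- 1ℚ) :+ b) :* (c :* con 1ℚ :+ d))) refl a b c d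

0<q₋q₊ : ∀ μ → Bounded μ → 0ℚ < q₋ μ * q₊ μ
0<q₋q₊ μ bd with bounded⇒endpoints μ bd
... | inj₁ (0<q₋ , 0<q₊) = positive⁻¹ _
  {{pos*pos⇒pos (q₋ μ) {{positive 0<q₋}} (q₊ μ) {{positive 0<q₊}}}}
... | inj₂ (q₋<0 , q₊<0) = positive⁻¹ _
  {{neg*neg⇒pos (q₋ μ) {{negative q₋<0}} (q₊ μ) {{negative q₊<0}}}}

det≥0 : ∀ φ → 0ℚ ≤ det ⟦ φ ⟧
det≥0 L = ≤ᵇ⇒≤ _
det≥0 R = ≤ᵇ⇒≤ _
det≥0 M = ≤ᵇ⇒≤ _

-- The rows of the matrix by which composition with φ acts on (q₋ , q₊).
w₋ w₊ : Digit → ℚ × ℚ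
w₋ L = 1ℚ , 0ℚ
w₋ R = 1ℚ , 1ℚ
w₋ M = + 2 / 1 , 1ℚ
w₊ L = 1ℚ , 1ℚ
w₊ R = 0ℚ , 1ℚ
w₊ M = 1ℚ , + 2 / 1

infix 8 _∙_

_∙_ : ℚ × ℚ → ℚ × ℚ → ℚ
(u , v) ∙ (u′ , v′) = u * u′ + v * v′

-- The vector of numerator and denominator of φ at -1 is the combination of (-1, 1) and (1, 1) with
-- weights `w₋ φ`, and the denominator of μ is linear in such vectors. The same holds at 1 with
-- `w₊ φ`.
q₋-∘ : ∀ μ φ → q₋ (μ ∘ ⟦ φ ⟧) ≡ w₋ φ ∙ (q₋ μ , q₊ μ)
q₋-∘ (mob _ _ c d) L = solve 2 (λ c d →
  (c :* con ½ :+ d :* con ½) :* con (- 1ℚ) :+ (c :* con -½ :+ d :* con (+ 3 / 2))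
  := con 1ℚ :* (c :* con (- 1ℚ) :+ d) :+ con 0ℚ :* (c :* con 1ℚ :+ d)) refl c d
q₋-∘ (mob _ _ c d) R = solve 2 (λ c d →
  (c :* con ½ :+ d :* con -½) :* con (- 1ℚ) :+ (c :* con ½ :+ d :* con (+ 3 / 2))
  := con 1ℚ :* (c :* con (- 1ℚ) :+ d) :+ con 1ℚ :* (c :* con 1ℚ :+ d)) refl c d
q₋-∘ (mob _ _ c d) M = solve 2 (λ c d →
  (c :* con 1ℚ :+ d :* con 0ℚ) :* con (- 1ℚ) :+ (c :* con 0ℚ :+ d :* con (+ 3 / 1))
  := con (+ 2 / 1) :* (c :* con (- 1ℚ) :+ d) :+ con 1ℚ :* (c :* con 1ℚ :+ d)) refl c d

q₊-∘ : ∀ μ φ → q₊ (μ ∘ ⟦ φ ⟧) ≡ w₊ φ ∙ (q₋ μ , q₊ μ)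
q₊-∘ (mob _ _ c d) L = solve 2 (λ c d →
  (c :* con ½ :+ d :* con ½) :* con 1ℚ :+ (c :* con -½ :+ d :* con (+ 3 / 2))
  := con 1ℚ :* (c :* con (- 1ℚ) :+ d) :+ con 1ℚ :* (c :* con 1ℚ :+ d)) refl c d
q₊-∘ (mob _ _ c d) R = solve 2 (λ c d →
  (c :* con ½ :+ d :* con -½) :* con 1ℚ :+ (c :* con ½ :+ d :* con (+ 3 / 2))
  := con 0ℚ :* (c :* con (- 1ℚ) :+ d) :+ con 1ℚ :* (c :* con 1ℚ :+ d)) refl c d
q₊-∘ (mob _ _ c d) M = solve 2 (λ c d →
  (c :* con 1ℚ :+ d :* con 0ℚ) :* con 1ℚ :+ (c :* con 0ℚ :+ d :* con (+ 3 / 1))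
  := con 1ℚ :* (c :* con (- 1ℚ) :+ d) :+ con (+ 2 / 1) :* (c :* con 1ℚ :+ d)) refl c d

-- Expand the product: `ε` bounds both squares from below, and the mixed term is kept as a multiple
-- of `q * q′`. Taking equal weight vectors gives the bounds for the new squares, taking the two
-- rows gives the bound for the new product.
product-growth : ∀ ε q q′ → 0ℚ ≤ ε → ε ≤ q * q → ε ≤ q′ * q′ → 0ℚ ≤ q * q′ →
  ∀ k l ((u , v) : ℚ × ℚ) ((u′ , v′) : ℚ × ℚ) →
  0ℚ ≤ u * u′ → 0ℚ ≤ v * v′ → k ≤ u * u′ + v * v′ → l ≤ u * v′ + v * u′ →
  k * ε + l * (q * q′) ≤ (u * q + v * q′) * (u′ * q + v′ * q′)
product-growth ε q q′ 0≤ε ε≤q² ε≤q′² 0≤qq′ k l (u , v) (u′ , v′) 0≤uu′ 0≤vv′ k≤ l≤ = begin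
  k * ε + l * (q * q′)
    ≤⟨ +-mono-≤ (*-monoʳ-≤-nonNeg ε {{nonNegative 0≤ε}} k≤)
                (*-monoʳ-≤-nonNeg (q * q′) {{nonNegative 0≤qq′}} l≤) ⟩
  (u * u′ + v * v′) * ε + (u * v′ + v * u′) * (q * q′)
    ≡⟨ cong (λ t → t + (u * v′ + v * u′) * (q * q′)) (*-distribʳ-+ ε (u * u′) (v * v′)) ⟩
  (u * u′ * ε + v * v′ * ε) + (u * v′ + v * u′) * (q * q′)
    ≤⟨ +-monoˡ-≤ ((u * v′ + v * u′) * (q * q′))
         (+-mono-≤ (*-monoˡ-≤-nonNeg (u * u′) {{nonNegative 0≤uu′}} ε≤q²)
                   (*-monoˡ-≤-nonNeg (v * v′) {{nonNegative 0≤vv′}} ε≤q′²)) ⟩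
  (u * u′ * (q * q) + v * v′ * (q′ * q′)) + (u * v′ + v * u′) * (q * q′)
    ≡⟨ expand u v u′ v′ q q′ ⟨
  (u * q + v * q′) * (u′ * q + v′ * q′) ∎
  where
  open ≤-Reasoning
  expand : ∀ u v u′ v′ q q′ → (u * q + v * q′) * (u′ * q + v′ * q′)
    ≡ (u * u′ * (q * q) + v * v′ * (q′ * q′)) + (u * v′ + v * u′) * (q * q′)
  expand = solve 6 (λ u v u′ v′ q q′ → (u :* q :+ v :* q′) :* (u′ :* q :+ v′ :* q′)
    := (u :* u′ :* (q :* q) :+ v :* v′ :* (q′ :* q′)) :+ (u :* v′ :+ v :* u′) :* (q :* q′)) refl

-- `n` is the number of absorptions still to be made, each of which uses up one `ε`. At `n` = 0 the
-- last field says that the image has width at most 1/3. Squares appear because the endpoint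
-- denominators may both be negative.
record Narrow (n : ℕ) (μ : Möbius) : Set where
  field
    ε        : ℚ
    0≤ε      : 0ℚ ≤ ε
    ε≤q₋²    : ε ≤ q₋ μ * q₋ μ
    ε≤q₊²    : ε ≤ q₊ μ * q₊ μ
    3∣cross∣≤ : + 3 / 1 * ∣ cross μ ∣ ≤ q₋ μ * q₊ μ + n · ε

narrow-absorb : ∀ n μ φ → Bounded μ → Narrow (suc n) μ → Narrow n (μ ∘ ⟦ φ ⟧)
narrow-absorb n μ φ bd narrow = record
  { ε = k * ε
  ; 0≤ε = *-nonNeg (det≥0 φ) 0≤ε
  ; ε≤q₋² = subst₂ (λ p q → p ≤ q * q) (drop-0 (k * ε)) (sym (q₋-∘ μ φ)) (square₋ φ)
  ; ε≤q₊² = subst₂ (λ p q → p ≤ q * q) (drop-0 (k * ε)) (sym (q₊-∘ μ φ)) (square₊ φ)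
  ; 3∣cross∣≤ = begin
      + 3 / 1 * ∣ cross (μ ∘ ⟦ φ ⟧) ∣
        ≡⟨ cong (λ c → + 3 / 1 * c) ∣cross∣-∘ ⟩
      + 3 / 1 * (k * ∣ cross μ ∣)
        ≡⟨ swap k ∣ cross μ ∣ ⟩
      k * (+ 3 / 1 * ∣ cross μ ∣)
        ≤⟨ *-monoˡ-≤-nonNeg k {{nonNegative (det≥0 φ)}} 3∣cross∣≤ ⟩
      -- One summand `ε` is split off from `suc n · ε`. It pays for the growth of the product of the
      -- denominators.
      k * (q * q′ + (ε + n · ε))
        ≡⟨ distribute k (q * q′) ε (n · ε) ⟩
      (k * ε + k * (q * q′)) + k * (n · ε)
        ≡⟨ cong (λ t → (k * ε + k * (q * q′)) + t) (×-comm-* n k ε) ⟩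
      (k * ε + k * (q * q′)) + n · (k * ε)
        ≤⟨ +-monoˡ-≤ (n · (k * ε)) (product φ) ⟩
      w₋ φ ∙ (q , q′) * w₊ φ ∙ (q , q′) + n · (k * ε)
        ≡⟨ cong₂ (λ r s → r * s + n · (k * ε)) (q₋-∘ μ φ) (q₊-∘ μ φ) ⟨
      q₋ (μ ∘ ⟦ φ ⟧) * q₊ (μ ∘ ⟦ φ ⟧) + n · (k * ε) ∎
  }
  where
  open Narrow narrow
  open ≤-Reasoning
  k q q′ : ℚ
  k = det ⟦ φ ⟧
  q = q₋ μ
  q′ = q₊ μ
  growth = product-growth ε q q′ 0≤ε ε≤q₋² ε≤q₊² (<⇒≤ (0<q₋q₊ μ bd))
  ∣cross∣-∘ : ∣ cross (μ ∘ ⟦ φ ⟧) ∣ ≡ k * ∣ cross μ ∣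
  ∣cross∣-∘ = trans (cong ∣_∣ (cross-∘ μ φ)) (trans (∣p*q∣≡∣p∣*∣q∣ k (cross μ))
    (cong (_* ∣ cross μ ∣) (0≤p⇒∣p∣≡p (det≥0 φ))))
  swap : ∀ k c → + 3 / 1 * (k * c) ≡ k * (+ 3 / 1 * c)
  swap = solve 2 (λ k c → con (+ 3 / 1) :* (k :* c) := k :* (con (+ 3 / 1) :* c)) refl
  distribute : ∀ k p e t → k * (p + (e + t)) ≡ (k * e + k * p) + k * t
  distribute = solve 4 (λ k p e t →
    k :* (p :+ (e :+ t)) := (k :* e :+ k :* p) :+ k :* t) refl
  drop-0 : ∀ t → t + 0ℚ * (q * q′) ≡ t
  drop-0 t = trans (cong (λ s → t + s) (*-zeroˡ (q * q′))) (+-identityʳ t)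
  -- In a square the mixed term is nonnegative and is discarded, hence the coefficient 0.
  square₋ : ∀ φ → det ⟦ φ ⟧ * ε + 0ℚ * (q * q′) ≤ w₋ φ ∙ (q , q′) * w₋ φ ∙ (q , q′)
  square₋ L = growth (det ⟦ L ⟧) 0ℚ (w₋ L) (w₋ L) (≤ᵇ⇒≤ _) (≤ᵇ⇒≤ _) (≤ᵇ⇒≤ _) (≤ᵇ⇒≤ _)
  square₋ R = growth (det ⟦ R ⟧) 0ℚ (w₋ R) (w₋ R) (≤ᵇ⇒≤ _) (≤ᵇ⇒≤ _) (≤ᵇ⇒≤ _) (≤ᵇ⇒≤ _)
  square₋ M = growth (det ⟦ M ⟧) 0ℚ (w₋ M) (w₋ M) (≤ᵇ⇒≤ _) (≤ᵇ⇒≤ _) (≤ᵇ⇒≤ _) (≤ᵇ⇒≤ _)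
  square₊ : ∀ φ → det ⟦ φ ⟧ * ε + 0ℚ * (q * q′) ≤ w₊ φ ∙ (q , q′) * w₊ φ ∙ (q , q′)
  square₊ L = growth (det ⟦ L ⟧) 0ℚ (w₊ L) (w₊ L) (≤ᵇ⇒≤ _) (≤ᵇ⇒≤ _) (≤ᵇ⇒≤ _) (≤ᵇ⇒≤ _)
  square₊ R = growth (det ⟦ R ⟧) 0ℚ (w₊ R) (w₊ R) (≤ᵇ⇒≤ _) (≤ᵇ⇒≤ _) (≤ᵇ⇒≤ _) (≤ᵇ⇒≤ _)
  square₊ M = growth (det ⟦ M ⟧) 0ℚ (w₊ M) (w₊ M) (≤ᵇ⇒≤ _) (≤ᵇ⇒≤ _) (≤ᵇ⇒≤ _) (≤ᵇ⇒≤ _)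
  -- Here the coefficients of the squares sum to 1, 1, 4 for `L`, `R`, `M`, and the mixed
  -- coefficients are 1, 1, 5. Both dominate the determinants 1, 1, 3.
  product : ∀ φ → det ⟦ φ ⟧ * ε + det ⟦ φ ⟧ * (q * q′) ≤ w₋ φ ∙ (q , q′) * w₊ φ ∙ (q , q′)
  product L = growth (det ⟦ L ⟧) (det ⟦ L ⟧) (w₋ L) (w₊ L) (≤ᵇ⇒≤ _) (≤ᵇ⇒≤ _) (≤ᵇ⇒≤ _) (≤ᵇ⇒≤ _)
  product R = growth (det ⟦ R ⟧) (det ⟦ R ⟧) (w₋ R) (w₊ R) (≤ᵇ⇒≤ _) (≤ᵇ⇒≤ _) (≤ᵇ⇒≤ _) (≤ᵇ⇒≤ _)
  product M = growth (det ⟦ M ⟧) (det ⟦ M ⟧) (w₋ M) (w₊ M) (≤ᵇ⇒≤ _) (≤ᵇ⇒≤ _) (≤ᵇ⇒≤ _) (≤ᵇ⇒≤ _)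

0<p*p : ∀ {p} → p ≢ 0ℚ → 0ℚ < p * p
0<p*p {p} p≢0 = ≤∧≢⇒< (subst (0ℚ ≤_) (sym (∣p∣²≡p² p)) (*-nonNeg (0≤∣p∣ p) (0≤∣p∣ p)))
  (λ eq → *-nonZero p≢0 p≢0 (sym eq))
  where
  neg-square : ∀ p → p * p ≡ - p * - p
  neg-square = solve 1 (λ p → p :* p := (:- p) :* (:- p)) refl
  ∣p∣²≡p² : ∀ p → p * p ≡ ∣ p ∣ * ∣ p ∣
  ∣p∣²≡p² p with ∣p∣≡p∨∣p∣≡-p p
  ... | inj₁ eq = sym (cong₂ _*_ eq eq)
  ... | inj₂ eq = trans (neg-square p) (sym (cong₂ _*_ eq eq))

-- Boundedness makes the smaller of the two squares positive, so some multiple of it exceeds any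
-- bound. The product of the denominators is positive and only helps.
narrow-eventually : ∀ μ → Bounded μ → ∃ λ n → Narrow n μ
narrow-eventually μ bd = n , record
  { ε = ε
  ; 0≤ε = <⇒≤ 0<ε
  ; ε≤q₋² = p⊓q≤p (q₋ μ * q₋ μ) (q₊ μ * q₊ μ)
  ; ε≤q₊² = p⊓q≤q (q₋ μ * q₋ μ) (q₊ μ * q₊ μ)
  ; 3∣cross∣≤ = ≤-trans (proj₂ bound)
      (subst (_≤ q₋ μ * q₊ μ + n · ε) (+-identityˡ (n · ε))
        (+-monoˡ-≤ (n · ε) (<⇒≤ (0<q₋q₊ μ bd))))
  }
  where
  ε : ℚ
  ε = (q₋ μ * q₋ μ) ⊓ (q₊ μ * q₊ μ)
  0<ε : 0ℚ < ε
  0<ε with ⊓-sel (q₋ μ * q₋ μ) (q₊ μ * q₊ μ)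
  ... | inj₁ eq = subst (0ℚ <_) (sym eq) (0<p*p (bd (- 1ℚ) -1∈I))
  ... | inj₂ eq = subst (0ℚ <_) (sym eq) (0<p*p (bd 1ℚ 1∈I))
  bound : ∃ λ n → + 3 / 1 * ∣ cross μ ∣ ≤ n · ε
  bound = archimedean _ 0<ε
  n : ℕ
  n = proj₁ bound

-- Emission from a narrow image.

p≤∣p∣ : ∀ p → p ≤ ∣ p ∣
p≤∣p∣ p with ≤-total 0ℚ p
... | inj₁ 0≤p = ≤-reflexive (sym (0≤p⇒∣p∣≡p 0≤p))
... | inj₂ p≤0 = ≤-trans p≤0 (0≤∣p∣ p)

narrow⇒Eₕ : ∀ μ α → Refining μ → Narrow 0 μ → Eₕ μ α
narrow⇒Eₕ μ α (bd , sub) narrow = split (≤-total e₋ 0ℚ) (≤-total e₊ 0ℚ)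
  where
  open Narrow narrow
  e₋ e₊ : ℚ
  e₋ = apply μ (- 1ℚ) (bd (- 1ℚ) -1∈I)
  e₊ = apply μ 1ℚ (bd 1ℚ 1∈I)
  e₋∈I : e₋ ∈ I
  e₋∈I = sub (- 1ℚ , -1∈I , bd (- 1ℚ) -1∈I , refl)
  e₊∈I : e₊ ∈ I
  e₊∈I = sub (1ℚ , 1∈I , bd 1ℚ 1∈I , refl)
  -- By monotonicity the endpoint values enclose the whole image.
  incl : ∀ φ → e₋ ∈ Between (lower φ) (upper φ) → e₊ ∈ Between (lower φ) (upper φ) → Incl μ φ
  incl φ b₋ b₊ = bd , λ z∈ → between⇒image φ (image-between μ bd _ _ b₋ b₊ z∈)
  cross≡ : cross μ ≡ (e₊ - e₋) * (q₋ μ * q₊ μ)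
  cross≡ = trans (cong₂ (λ p₊ p₋ → p₊ * q₋ μ - p₋ * q₊ μ)
      (sym (apply-*-den μ 1ℚ (bd 1ℚ 1∈I))) (sym (apply-*-den μ (- 1ℚ) (bd (- 1ℚ) -1∈I))))
    (collect e₊ e₋ (q₋ μ) (q₊ μ))
    where
    collect : ∀ s r p q → (s * q) * p - (r * p) * q ≡ (s - r) * (p * q)
    collect = solve 4 (λ s r p q → (s :* q) :* p :- (r :* p) :* q := (s :- r) :* (p :* q)) refl
  width : + 3 / 1 * ∣ e₊ - e₋ ∣ ≤ 1ℚ
  width = *-cancelʳ-≤-pos (q₋ μ * q₊ μ) {{positive (0<q₋q₊ μ bd)}} (subst₂ _≤_
    (trans (cong (λ t → + 3 / 1 * t) (trans (cong ∣_∣ cross≡)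
      (trans (∣p*q∣≡∣p∣*∣q∣ (e₊ - e₋) (q₋ μ * q₊ μ))
        (cong (∣ e₊ - e₋ ∣ *_) (0≤p⇒∣p∣≡p (<⇒≤ (0<q₋q₊ μ bd)))))))
      (sym (*-assoc (+ 3 / 1) ∣ e₊ - e₋ ∣ (q₋ μ * q₊ μ))))
    (trans (+-identityʳ (q₋ μ * q₊ μ)) (sym (*-identityˡ (q₋ μ * q₊ μ))))
    3∣cross∣≤)
  -- Needed when the map reverses orientation, so that the image of 1 is the left end.
  width′ : + 3 / 1 * ∣ e₋ - e₊ ∣ ≤ 1ℚ
  width′ = subst (λ t → + 3 / 1 * t ≤ 1ℚ)
    (trans (sym (∣-p∣≡∣p∣ (e₊ - e₋))) (cong ∣_∣ (neg-diff e₊ e₋))) width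
    where
    neg-diff : ∀ s r → - (s - r) ≡ r - s
    neg-diff = solve 2 (λ s r → :- (s :- r) := r :- s) refl
  straddle : ∀ {r s} → r ≤ 0ℚ → 0ℚ ≤ s → + 3 / 1 * ∣ s - r ∣ ≤ 1ℚ →
    r ∈ Between (lower M) (upper M) × s ∈ Between (lower M) (upper M)
  straddle {r} {s} r≤0 0≤s h =
    -- From s - r ≤ 1/3 follow r ≥ s - 1/3 ≥ -1/3 and s ≤ r + 1/3 ≤ 1/3.
    (0≤q-p⁻¹ (subst (0ℚ ≤_) (eq₁ r s) (+-nonNeg 0≤third-diff 0≤s)) , ≤-trans r≤0 (≤ᵇ⇒≤ _)) ,
    (≤-trans (≤ᵇ⇒≤ _) 0≤s ,
     0≤q-p⁻¹ (subst (0ℚ ≤_) (eq₂ r s) (+-nonNeg 0≤third-diff (neg-antimono-≤ r≤0))))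
    where
    diff≤third : s - r ≤ + 1 / 3
    diff≤third = ≤-trans (p≤∣p∣ (s - r)) (*-cancelˡ-≤-pos (+ 3 / 1) h)
    0≤third-diff : 0ℚ ≤ + 1 / 3 - (s - r)
    0≤third-diff = 0≤q-p diff≤third
    eq₁ : ∀ r s → (+ 1 / 3 - (s - r)) + s ≡ r - - (+ 1 / 3)
    eq₁ = solve 2 (λ r s → (con (+ 1 / 3) :- (s :- r)) :+ s := r :- con (- (+ 1 / 3))) refl
    eq₂ : ∀ r s → (+ 1 / 3 - (s - r)) + - r ≡ + 1 / 3 - s
    eq₂ = solve 2 (λ r s → (con (+ 1 / 3) :- (s :- r)) :+ :- r := con (+ 1 / 3) :- s) refl
  split : _ → _ → Eₕ μ α
  split (inj₁ e₋≤0) (inj₁ e₊≤0) = emit-L (incl L (proj₁ e₋∈I , e₋≤0) (proj₁ e₊∈I , e₊≤0))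
  split (inj₂ 0≤e₋) (inj₂ 0≤e₊) = emit-R (incl R (0≤e₋ , proj₂ e₋∈I) (0≤e₊ , proj₂ e₊∈I))
  split (inj₁ e₋≤0) (inj₂ 0≤e₊) =
    let b₋ , b₊ = straddle e₋≤0 0≤e₊ width in emit-M (incl M b₋ b₊)
  split (inj₂ 0≤e₋) (inj₁ e₊≤0) =
    let b₊ , b₋ = straddle e₊≤0 0≤e₋ width′ in emit-M (incl M b₋ b₊)

-- Productivity of refining maps.

-- The proof always absorbs `n` digits, even if an emission is possible earlier. This is harmless,
-- since `m̄ₕ` emits as soon as an inclusion holds, whatever the proof term does.
narrow-productive : ∀ n μ α → Refining μ → Narrow n μ → Eₕ μ α
narrow-productive zero    μ α ref narrow = narrow⇒Eₕ μ α ref narrow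
narrow-productive (suc n) μ α ref narrow = absorb (narrow-productive n (μ ∘ ⟦ hd α ⟧) (tl α)
  (refining-∘ μ ⟦ hd α ⟧ ref (digit-refining (hd α))) (narrow-absorb n μ (hd α) (proj₁ ref) narrow))

refining⇒Eₕ : ∀ μ α → Refining μ → Eₕ μ α
refining⇒Eₕ μ α ref =
  let n , narrow = narrow-eventually μ (proj₁ ref) in narrow-productive n μ α ref narrow

-- Being refining is the invariant: it yields the productivity proof for the current step and passes
-- to the map that remains after emission.
refining⇒Ψₕ : ∀ n μ α → Refining μ → Ψₕ n μ α
refining⇒Ψₕ zero    μ α ref = Ψ-zero (refining⇒Eₕ μ α ref)
refining⇒Ψₕ (suc n) μ α ref =
  Ψ-suc t (refining⇒Ψₕ n (π₂ (m̄ₕ μ α t)) (π₃ (m̄ₕ μ α t)) (m̄ₕ-refining μ α t ref))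
  where
  t : Eₕ μ α
  t = refining⇒Eₕ μ α ref

corollary6p11 : ∀ (μ : Möbius) (α : Stream Digit) → Refining μ → Pₕ μ α
corollary6p11 μ α ref n = refining⇒Ψₕ (suc n) μ α ref
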